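{- The unary operation $x\mapsto 2^x$ on $\mathbb{N}$ does not belong to $\langle x+y,\ x\bmod y\rangle$.
   Context: $\mathbb{N}$ is the set of non-negative integers. An ($r$-ary, $r\ge 1$) operation on $\mathbb{N}$ is a function $\mathbb{N}^r\to\mathbb{N}$. Conventions: $\lfloor x/0\rfloor:=0$, and $x\bmod y:=\max(x-y\lfloor x/y\rfloor,0)$, so that $x\bmod 0=x$. A set $S$ of operations on $\mathbb{N}$ is closed under substitution if, whenever $f\in S$ is $r$-ary and $g_1,\dots,g_r\in S$ are $n$-ary, the operation $\vec x\mapsto f(g_1(\vec x),\dots,g_r(\vec x))$ is in $S$. For a set $\mathcal{B}$ of operations on $\mathbb{N}$, $\langle\mathcal{B}\rangle$ denotes the closure under substitution of $\mathcal{B}\cup C\cup P$, where $C$ is the set of all constant operations on $\mathbb{N}$ (of every arity) and $P$ is the set of all projections $(x_1,\dots,x_n)\mapsto x_i$. Here $x+y$ and $x\bmod y$ denote the corresponding binary operations. -}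

module Defs where

open import Data.Fin.Base using (Fin)
open import Data.Nat.Base using (ℕ; zero; suc; _*_; _∸_; _/_; NonZero)
open import Data.Product.Base using (∃-syntax)
open import Data.Vec.Base using (Vec; []; _∷_; lookup; tabulate)
open import Level using (0ℓ)
open import Relation.Binary.PropositionalEquality using (_≡_; _≗_)
open import Relation.Unary using (Pred; _∈_)

infixl 7 _div_ _mod_

-- Truncated to total functions: ⌊ x / 0 ⌋ = 0, hence x mod 0 = x.
-- Since _∸_ is truncated subtraction, x ∸ z is max (x - z) 0.
_div_ : ℕ → ℕ → ℕ
x div zero      = 0
x div y@(suc _) = x / y

_mod_ : ℕ → ℕ → ℕ
x mod y = x ∸ y * (x div y)

Operation : (r : ℕ) .{{_ : NonZero r}} → Set
Operation r = Vec ℕ r → ℕ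

unary : (ℕ → ℕ) → Operation 1
unary f (x ∷ []) = f x

binary : (ℕ → ℕ → ℕ) → Operation 2
binary f (x ∷ y ∷ []) = f x y

OperationSet : Set₁
OperationSet = (r : ℕ) .{{_ : NonZero r}} → Pred (Operation r) 0ℓ

IsConstant : ∀ {r} .{{_ : NonZero r}} → Pred (Operation r) 0ℓ
IsConstant f = ∃[ c ] (∀ xs → f xs ≡ c)

IsProjection : ∀ {r} .{{_ : NonZero r}} → Pred (Operation r) 0ℓ
IsProjection f = ∃[ i ] (∀ xs → f xs ≡ lookup xs i)

substitute : ∀ {r n} .{{_ : NonZero r}} .{{_ : NonZero n}} →
             Operation r → (Fin r → Operation n) → Operation n
substitute f g xs = f (tabulate (λ i → g i xs))

ClosedUnderSubstitution : OperationSet → Set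
ClosedUnderSubstitution S =
  ∀ {r n} .{{_ : NonZero r}} .{{_ : NonZero n}}
    {f : Operation r} {g : Fin r → Operation n} →
  f ∈ S r → (∀ i → g i ∈ S n) → substitute f g ∈ S n

-- Operations are functions in the set-theoretic sense, so sets of them must
-- not distinguish pointwise equal functions; without function extensionality
-- this has to be required explicitly.
Extensional : OperationSet → Set
Extensional S = ∀ {r} .{{_ : NonZero r}} {f g : Operation r} →
                f ≗ g → f ∈ S r → g ∈ S r

data ⟨_⟩ (B : OperationSet) : OperationSet where
  generator    : ∀ {r} .{{_ : NonZero r}} {f : Operation r} →
                 f ∈ B r → f ∈ ⟨ B ⟩ r
  constant     : ∀ {r} .{{_ : NonZero r}} {f : Operation r} →
                 IsConstant f → f ∈ ⟨ B ⟩ r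
  projection   : ∀ {r} .{{_ : NonZero r}} {f : Operation r} →
                 IsProjection f → f ∈ ⟨ B ⟩ r
  substitution : ∀ {r n} .{{_ : NonZero r}} .{{_ : NonZero n}}
                 {f : Operation r} {g : Fin r → Operation n} →
                 f ∈ ⟨ B ⟩ r → (∀ i → g i ∈ ⟨ B ⟩ n) →
                 substitute f g ∈ ⟨ B ⟩ n
  extensional  : ∀ {r} .{{_ : NonZero r}} {f g : Operation r} →
                 f ≗ g → f ∈ ⟨ B ⟩ r → g ∈ ⟨ B ⟩ r

⟨⟩-closed : ∀ {B} → ClosedUnderSubstitution ⟨ B ⟩
⟨⟩-closed = substitution

⟨⟩-least : ∀ {B} (S : OperationSet) → Extensional S →
           ClosedUnderSubstitution S →
           (∀ {r} .{{_ : NonZero r}} {f : Operation r} → f ∈ B r → f ∈ S r) →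
           (∀ {r} .{{_ : NonZero r}} {f : Operation r} → IsConstant f → f ∈ S r) →
           (∀ {r} .{{_ : NonZero r}} {f : Operation r} → IsProjection f → f ∈ S r) →
           ∀ {r} .{{_ : NonZero r}} {f : Operation r} → f ∈ ⟨ B ⟩ r → f ∈ S r
⟨⟩-least {B} S ext closed gen con proj = go
  where
  go : ∀ {r} .{{_ : NonZero r}} {f : Operation r} → f ∈ ⟨ B ⟩ r → f ∈ S r
  go (generator {{nz}} p)      = gen {{nz}} p
  go (constant {{nz}} p)       = con {{nz}} p
  go (projection {{nz}} p)     = proj {{nz}} p
  go (substitution p q) = closed (go p) (λ i → go (q i))
  go (extensional eq p) = ext eq (go p)

data ｛_,_｝ (f g : Operation 2) : OperationSet where
  left  : f ∈ ｛ f , g ｝ 2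
  right : g ∈ ｛ f , g ｝ 2

{-# OPTIONS --safe #-}

-- Addition and mod are bounded linearly in the largest argument, and such
-- bounds persist under substitution, whereas 2 ^ x outgrows all of them.
module Submission where

open import Defs
open import Data.Fin.Base using (Fin; zero; suc)
open import Data.Nat.Base using (ℕ; zero; suc; _+_; _*_; _^_; _≤_; _<_; _⊔_; z≤n; s≤s; NonZero)
open import Data.Nat.Properties
open import Data.Nat.Tactic.RingSolver using (solve-∀)
open import Data.Product.Base using (∃-syntax; _,_; proj₁; proj₂)
open import Data.Vec.Base using ([]; _∷_; lookup; tabulate)
open import Data.Vec.Properties using (lookup∘tabulate)
open import Relation.Binary.PropositionalEquality using (_≡_; cong; subst)
open import Relation.Unary using (_∈_; _∉_)

-- Induction over the closure shows that each of its operations has a constant `c` with all values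
-- at most `c * (m + 1)` whenever the arguments are at most `m`. The factor is `m + 1`, not `m`, so
-- that nonzero constant operations qualify even at `m = 0`. The decisive case is substitution,
-- where the constants essentially multiply. An exponential admits no such `c`.

LinearlyBounded : OperationSet
LinearlyBounded r f =
  ∃[ c ] (∀ m xs → (∀ i → lookup xs i ≤ m) → f xs ≤ c * suc m)

-- Gives the inner operations of a substitution, each with its own constant, a common one.
Fin-bounded : ∀ {n} (h : Fin n → ℕ) → ∃[ C ] (∀ i → h i ≤ C)
Fin-bounded {zero}  h = 0 , λ ()
Fin-bounded {suc n} h with C , h≤C ← Fin-bounded (λ i → h (suc i)) =
  h zero ⊔ C , λ where
    zero    → m≤m⊔n (h zero) C
    (suc i) → m≤n⇒m≤o⊔n (h zero) (h≤C i)

extensional-LinearlyBounded : Extensional LinearlyBounded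
extensional-LinearlyBounded f≗g (c , f≤) =
  c , λ m xs xs≤m → subst (_≤ c * suc m) (f≗g xs) (f≤ m xs xs≤m)

closed-LinearlyBounded : ClosedUnderSubstitution LinearlyBounded
closed-LinearlyBounded {f = f} {g = g} (c , f≤) g-bounded
  with C , c≤C ← Fin-bounded (λ i → proj₁ (g-bounded i)) = c * suc C , bound
  where
  open ≤-Reasoning
  bound : ∀ m xs → (∀ i → lookup xs i ≤ m) →
          substitute f g xs ≤ c * suc C * suc m
  bound m xs xs≤m = begin
    substitute f g xs      ≤⟨ f≤ (C * suc m) _ gs≤ ⟩
    -- The bound for `f` is used with `C * suc m` in the role of `m`; the extra 1 is absorbed by a
    -- further summand `suc m`.
    c * suc (C * suc m)    ≤⟨ *-monoʳ-≤ c (s≤s (m≤n+m (C * suc m) m)) ⟩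
    c * (suc C * suc m)    ≡⟨ *-assoc c (suc C) (suc m) ⟨
    c * suc C * suc m      ∎
    where
    gs≤ : ∀ i → lookup (tabulate (λ j → g j xs)) i ≤ C * suc m
    gs≤ i = begin
      lookup (tabulate (λ j → g j xs)) i  ≡⟨ lookup∘tabulate (λ j → g j xs) i ⟩
      g i xs                              ≤⟨ proj₂ (g-bounded i) m xs xs≤m ⟩
      proj₁ (g-bounded i) * suc m         ≤⟨ *-monoˡ-≤ (suc m) (c≤C i) ⟩
      C * suc m                           ∎

constant-LinearlyBounded : ∀ {r} .{{_ : NonZero r}} {f : Operation r} →
                           IsConstant f → f ∈ LinearlyBounded r
constant-LinearlyBounded (c , f≡c) =
  c , λ m xs _ → ≤-trans (≤-reflexive (f≡c xs)) (m≤m*n c (suc m))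

projection-LinearlyBounded : ∀ {r} .{{_ : NonZero r}} {f : Operation r} →
                             IsProjection f → f ∈ LinearlyBounded r
projection-LinearlyBounded (i , f≡xᵢ) = 1 , λ m xs xs≤m →
  ≤-trans (≤-reflexive (f≡xᵢ xs))
  (≤-trans (xs≤m i) (≤-trans (n≤1+n m) (m≤n*m (suc m) 1)))

-- As a truncated difference, `x mod y` never exceeds `x`, so a zero divisor needs no separate case.
generator-LinearlyBounded : ∀ {r} .{{_ : NonZero r}} {f : Operation r} →
                            f ∈ ｛ binary _+_ , binary _mod_ ｝ r →
                            f ∈ LinearlyBounded r
generator-LinearlyBounded left = 2 , λ where
  m (x ∷ y ∷ []) xs≤m →
    +-mono-≤ (m≤n⇒m≤1+n (xs≤m zero))
             (≤-trans (m≤n⇒m≤1+n (xs≤m (suc zero))) (m≤m+n (suc m) 0))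
generator-LinearlyBounded right = 1 , λ where
  m (x ∷ y ∷ []) xs≤m →
    ≤-trans (m∸n≤m x (y * (x div y)))
    (≤-trans (m≤n⇒m≤1+n (xs≤m zero)) (m≤n*m (suc m) 1))

n<2^n : ∀ n → n < 2 ^ n
n<2^n zero    = s≤s z≤n
n<2^n (suc n) = begin-strict
  suc n                <⟨ s≤s (n<2^n n) ⟩
  1 + 2 ^ n            ≤⟨ +-monoˡ-≤ (2 ^ n) (m^n>0 2 n) ⟩
  2 ^ n + 2 ^ n        ≡⟨ cong (2 ^ n +_) (+-identityʳ (2 ^ n)) ⟨
  2 ^ suc n            ∎
  where open ≤-Reasoning

-- By 2 ^ c > c, the value at 3c is at least (c + 1)³ > c (3c + 1).
2^-not-LinearlyBounded : unary (2 ^_) ∉ LinearlyBounded 1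
2^-not-LinearlyBounded (c , 2^≤) = <⇒≱ large (2^≤ (c + c + c) (_ ∷ []) λ { zero → ≤-refl })
  where
  open ≤-Reasoning
  cube : ∀ c → suc c * suc c * suc c ≡ suc (c * suc (c + c + c)) + (c * c * c + (c + c))
  cube = solve-∀
  -- Tripling `c` makes the power a cube, against a bound only quadratic in `c`. Doubling would
  -- yield just (c + 1)², which is too small against c (2c + 1) once `c` is at least 2.
  large : c * suc (c + c + c) < 2 ^ (c + c + c)
  large = begin
    suc (c * suc (c + c + c))                            ≤⟨ m≤m+n _ _ ⟩
    suc (c * suc (c + c + c)) + (c * c * c + (c + c))    ≡⟨ cube c ⟨
    suc c * suc c * suc c                                ≤⟨ *-mono-≤ (*-mono-≤ (n<2^n c) (n<2^n c)) (n<2^n c) ⟩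
    2 ^ c * 2 ^ c * 2 ^ c                                ≡⟨ cong (_* 2 ^ c) (^-distribˡ-+-* 2 c c) ⟨
    2 ^ (c + c) * 2 ^ c                                  ≡⟨ ^-distribˡ-+-* 2 (c + c) c ⟨
    2 ^ (c + c + c)                                      ∎

theorem10 : unary (2 ^_) ∉ ⟨ ｛ binary _+_ , binary _mod_ ｝ ⟩ 1
theorem10 2^∈ = 2^-not-LinearlyBounded
  (⟨⟩-least LinearlyBounded
    (λ {r} {{nz}} → extensional-LinearlyBounded {r} {{nz}})
    closed-LinearlyBounded
    generator-LinearlyBounded
    constant-LinearlyBounded
    projection-LinearlyBounded
    2^∈)
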